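{- Let $A$ be a type with decidable equality, $B$ a type and $T:\mathcal P((A\times B)^*)$ downward prime. Then $\exists\mathrm{MPCF}_{A,B,T}\to\mathrm{GDC}_{A,B,T}$.
   Context: Setting: intuitionistic higher-order arithmetic with inductive types and extensional equality of predicates; no choice principle is assumed. $\mathcal P(A)$ denotes $A\to\mathrm{Prop}$, with $a\in P$ meaning $P(a)$. $A^*$ is the type of finite lists over $A$, $\varepsilon$ the empty list, $u@a$ the list $u$ with $a$ appended at the end, $\star$ concatenation; $a\in u$ means $a$ occurs in $u$. For $u:A^*$, $\alpha:\mathcal P(A)$, $u\subset\alpha$ means $\forall a,\ a\in u\to a\in\alpha$; a list $u$ determines the predicate $\langle u\rangle:=\lambda x.\,x\in u$. For $T:\mathcal P(A^*)$, $\langle T\rangle:=\{\alpha:\mathcal P(A)\mid\forall u^{A^*},\ u\subset\alpha\to u\in T\}$. For $P:\mathcal P(\mathcal P(A))$, $\lfloor P\rfloor:=\{u:A^*\mid\langle u\rangle\in P\}$. $B_\bot:=B+\mathbf 1$, with $b:B$ identified with its left injection and $\bot$ the extra element. Downward prime: $T:\mathcal P((A\times B)^*)$ is downward prime when $u\in T$ and $v\in T$ implies $u\star v\in T$. $\mathrm{GDC}$: for $X:\mathcal P((A\times B)^*)$ put $\phi(X):=\{u\mid u\in\lfloor\langle T\rangle\rfloor\wedge\forall a^A,\ \neg(\exists b^B,\ (a,b)\in u)\to\exists b^B,\ u@(a,b)\in X\}$; $T_{AB\mathrm{ap}}$ is the greatest fixed point of $\phi$. $T$ is $A$-$B$-approximable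 if $\varepsilon\in T_{AB\mathrm{ap}}$. $T$ has an $A$-$B$-choice function if there is $f:A\to B$ such that every $u:(A\times B)^*$ with $u\subset\mathcal G(f)$ is in $T$, where $\mathcal G(f)=\{(a,b)\mid f(a)=b\}$. $\mathrm{GDC}_{A,B,T}$ is: if $T$ is $A$-$B$-approximable then $T$ has an $A$-$B$-choice function. $\exists\mathrm{MPCF}$: for $f:A\to B_\bot$, $\mathrm{dom}(f):=\lambda a.\,f(a)\neq\bot$ and $\mathcal G(f):=\{(a,b):A\times B\mid f(a)=b\}$. For $f,g:A\to B_\bot$, $g\prec f$ means there is $a:A$ with $a\notin\mathrm{dom}(f)$, $\mathrm{dom}(g)=\lambda x.\,(x\in\mathrm{dom}(f)\vee x=a)$, and $f(x)=g(x)$ for all $x\in\mathrm{dom}(f)$. $f\in\mathrm{Max}_{\mathrm{dpf}}(P)$ means $\mathcal G(f)\in P$ and for all $g:A\to B_\bot$, $g\prec f\to\mathcal G(g)\notin P$. $\exists\mathrm{MPCF}_{A,B,T}$ is: $(\exists\alpha^{\mathcal P(A\times B)},\ \alpha\in\langle T\rangle)\to\exists f^{A\to B_\bot},\ f\in\mathrm{Max}_{\mathrm{dpf}}(\langle T\rangle)$. -}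

module Defs where

open import Level using (Level; _⊔_; suc)
open import Data.Irrelevant as Irrelevant using (Irrelevant)
open import Data.List.Base using (List; []; _++_; _∷ʳ_)
open import Data.List.Membership.Propositional using () renaming (_∈_ to _∈ˡ_)
open import Data.Maybe.Base using (Maybe; just; nothing)
open import Data.Product.Base as Product using (Σ; ∃; _×_; _,_)
open import Data.Sum.Base using (_⊎_)
open import Relation.Binary.PropositionalEquality.Core using (_≡_; _≢_)
open import Relation.Nullary.Negation.Core using (¬_)
open import Relation.Unary using (Pred; _∈_; _∉_; _⊆_; _≐_)

private
  variable
    a b ℓ ℓ₁ ℓ₂ : Level
    A B : Set a

-- The existence and disjunction of a logic without choice.  A plain Σ would
-- make the axiom of choice provable, and with it GDC for every downward prime
-- T.  Squashing the witness with Irrelevant prevents this: it can be used only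
-- to establish other squashed statements or a contradiction.

∃ₚ : {A : Set a} → (A → Set b) → Set (a ⊔ b)
∃ₚ P = Irrelevant (∃ P)

infixr 1 _∨_

_∨_ : Set a → Set b → Set (a ⊔ b)
P ∨ Q = Irrelevant (P ⊎ Q)

infix 4 _⊂ˡ_

_⊂ˡ_ : List A → Pred A ℓ → Set _
u ⊂ˡ α = ∀ a → a ∈ˡ u → a ∈ α

⟨_⟩ˡ : {A : Set ℓ} → List A → Pred A ℓ
⟨ u ⟩ˡ = λ a → a ∈ˡ u

⟨_⟩ : {A : Set ℓ} → Pred (List A) ℓ → Pred (Pred A ℓ) ℓ
⟨ T ⟩ α = ∀ u → u ⊂ˡ α → u ∈ T

⌊_⌋ : {A : Set ℓ} → Pred (Pred A ℓ) ℓ → Pred (List A) ℓ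
⌊ P ⌋ u = ⟨ u ⟩ˡ ∈ P

DownwardPrime : {A B : Set ℓ} → Pred (List (A × B)) ℓ → Set ℓ
DownwardPrime T = ∀ u v → u ∈ T → v ∈ T → u ++ v ∈ T

module _ {A B : Set ℓ} (T : Pred (List (A × B)) ℓ) where

  φ : Pred (List (A × B)) ℓ₁ → Pred (List (A × B)) (ℓ ⊔ ℓ₁)
  φ X u = u ∈ ⌊ ⟨ T ⟩ ⌋
        × (∀ (a : A) → ¬ (∃ₚ λ (b : B) → (a , b) ∈ˡ u)
                     → ∃ₚ λ (b : B) → u ∷ʳ (a , b) ∈ X)

  -- The greatest fixed point of φ, as the union of its post-fixed points at
  -- level ℓ (the union itself is one level up, for want of impredicativity).
  -- Leaving this union unsquashed does not matter: GDC uses it only as a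
  -- hypothesis with a squashed conclusion.

  Ap : Pred (List (A × B)) (suc ℓ)
  Ap u = Σ (Pred (List (A × B)) ℓ) λ X → X ⊆ φ X × u ∈ X

  φ-mono : {X : Pred (List (A × B)) ℓ₁} {Y : Pred (List (A × B)) ℓ₂} →
           X ⊆ Y → φ X ⊆ φ Y
  φ-mono X⊆Y (u∈⌊⟨T⟩⌋ , ext) =
    u∈⌊⟨T⟩⌋ , λ a a∉u → Irrelevant.map (Product.map₂ X⊆Y) (ext a a∉u)

  Ap-greatest : (X : Pred (List (A × B)) ℓ) → X ⊆ φ X → X ⊆ Ap
  Ap-greatest X X⊆φX u∈X = X , (λ {v} → X⊆φX {v}) , u∈X

  Ap-postfixed : Ap ⊆ φ Ap
  Ap-postfixed (X , X⊆φX , u∈X) =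
    φ-mono {X = X} {Y = Ap} (Ap-greatest X X⊆φX) (X⊆φX u∈X)

  Approximable : Set (suc ℓ)
  Approximable = [] ∈ Ap

  graph : (A → B) → Pred (A × B) ℓ
  graph f (a , b) = f a ≡ b

  HasChoiceFunction : Set ℓ
  HasChoiceFunction = ∃ₚ λ (f : A → B) → ∀ u → u ⊂ˡ graph f → u ∈ T

  GDC : Set (suc ℓ)
  GDC = Approximable → HasChoiceFunction

-- Partial functions with decidable domain: nothing plays the role of ⊥.

module _ {A B : Set ℓ} where

  dom : (A → Maybe B) → Pred A ℓ
  dom f a = f a ≢ nothing

  graph⊥ : (A → Maybe B) → Pred (A × B) ℓ
  graph⊥ f (a , b) = f a ≡ just b

  infix 4 _≺_

  _≺_ : (g f : A → Maybe B) → Set ℓ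
  g ≺ f = ∃ₚ λ (a : A) → a ∉ dom f
                       × dom g ≐ (λ x → x ∈ dom f ∨ x ≡ a)
                       × (∀ x → x ∈ dom f → f x ≡ g x)

  Max-dpf : Pred (Pred (A × B) ℓ) ℓ → Pred (A → Maybe B) ℓ
  Max-dpf P f = graph⊥ f ∈ P × (∀ g → g ≺ f → graph⊥ g ∉ P)

∃MPCF : {A B : Set ℓ} → Pred (List (A × B)) ℓ → Set (suc ℓ)
∃MPCF {ℓ} {A} {B} T = (∃ₚ λ (α : Pred (A × B) ℓ) → α ∈ ⟨ T ⟩) →
                      ∃ₚ λ (f : A → Maybe B) → f ∈ Max-dpf ⟨ T ⟩

{-# OPTIONS --safe #-}
module Submission where

open import Defs
open import Data.Irrelevant as Irrelevant using (Irrelevant; [_])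
open import Data.List.Base using (List; []; _∷_)
open import Data.List.Relation.Unary.Any using (here; there)
open import Data.Maybe.Base using (Maybe; just; nothing)
open import Data.Product.Base using (∃; _×_; _,_; proj₁; proj₂)
open import Data.Sum.Base using (_⊎_; inj₁; inj₂)
open import Function.Base using (_∘_)
open import Level using (Level)
open import Relation.Binary.Definitions using (DecidableEquality)
open import Relation.Binary.PropositionalEquality.Core
  using (_≡_; _≢_; refl; trans; cong)
open import Relation.Nullary.Decidable.Core using (yes; no)
open import Relation.Nullary.Negation.Core using (¬_; contradiction; contradiction-irr)
open import Relation.Unary using (Pred; _∈_)

-- Downward primeness makes membership in ⟨ T ⟩ a condition on one-element
-- lists.  So if the maximal f were undefined at a, approximability at [] would
-- give some b with (a , b) compatible with T on its own, hence together with
-- the graph of f, and f could be extended by a ↦ b.  Thus f is total.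

private
  variable
    ℓ : Level
    A B : Set ℓ

-- A squashed witness may be unpacked only towards a contradiction. This suffices below because
-- membership in a domain is itself a negation.
irrelevant⇒¬¬ : Irrelevant A → ¬ ¬ A
irrelevant⇒¬¬ [ x ] ¬x = contradiction-irr x ¬x

-- Case analysis on `m` turns a negative fact into an unsquashed value; this is how totality of `f`
-- yields a function without any choice.
≢nothing⇒just : (m : Maybe B) → m ≢ nothing → ∃ λ b → m ≡ just b
≢nothing⇒just (just b) _  = b , refl
≢nothing⇒just nothing  m≢ = contradiction refl m≢

module _ {A B : Set ℓ} {T : Pred (List (A × B)) ℓ} where

  singleton-∈ : {α : Pred (A × B) ℓ} → α ∈ ⟨ T ⟩ → ∀ {p} → p ∈ α → p ∷ [] ∈ T
  singleton-∈ α∈⟨T⟩ p∈α = α∈⟨T⟩ (_ ∷ []) λ { _ (here refl) → p∈α }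

  -- Induction on the list: `p ∷ u` computes from `(p ∷ []) ++ u`, so primeness applies directly.
  singletons⇒∈⟨T⟩ : DownwardPrime T → [] ∈ T → {α : Pred (A × B) ℓ} →
                    (∀ p → p ∈ α → p ∷ [] ∈ T) → α ∈ ⟨ T ⟩
  singletons⇒∈⟨T⟩ prime []∈T sing []      u⊂α = []∈T
  singletons⇒∈⟨T⟩ prime []∈T sing (p ∷ u) u⊂α =
    prime (p ∷ []) u (sing p (u⊂α p (here refl)))
      (singletons⇒∈⟨T⟩ prime []∈T sing u (λ q → u⊂α q ∘ there))

module _ {A B : Set ℓ} (_≟_ : DecidableEquality A) (f : A → Maybe B)
         (a : A) (b : B) where

  extend : A → Maybe B
  extend x with x ≟ a
  ... | yes _ = just b
  ... | no  _ = f x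

  graph-extend : ∀ x y → extend x ≡ just y →
                 (x , y) ≡ (a , b) ⊎ (x , y) ∈ graph⊥ f
  graph-extend x y eq with x ≟ a
  graph-extend x y refl | yes refl = inj₁ refl
  graph-extend x y eq   | no  _    = inj₂ eq

  extend-≺ : f a ≡ nothing → extend ≺ f
  extend-≺ fa≡nothing =
    [ a , contradiction fa≡nothing
        , ((λ {x} → to x) , λ {x} x∈ eq → irrelevant⇒¬¬ x∈ (from x eq))
        , agree ]
    where
    to : ∀ x → x ∈ dom extend → x ∈ dom f ∨ x ≡ a
    to x x∈dom with x ≟ a
    ... | yes x≡a = [ inj₂ x≡a ]
    ... | no  _   = [ inj₁ x∈dom ]

    from : ∀ x → extend x ≡ nothing → ¬ (x ∈ dom f ⊎ x ≡ a)
    from x eq x∈ with x ≟ a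
    -- In the `yes` case `eq` would be `just b ≡ nothing`, so only `no` remains.
    from x eq (inj₁ x∈dom) | no _   = x∈dom eq
    from x eq (inj₂ x≡a)   | no x≢a = x≢a x≡a

    agree : ∀ x → x ∈ dom f → f x ≡ extend x
    agree x x∈dom with x ≟ a
    ... | yes refl = contradiction fa≡nothing x∈dom
    ... | no  _    = refl

module _ {A B : Set ℓ} (_≟_ : DecidableEquality A) {T : Pred (List (A × B)) ℓ}
         (prime : DownwardPrime T) (approx : Approximable T) where

  []∈T : [] ∈ T
  []∈T = proj₁ (Ap-postfixed T approx) [] λ _ ()

  -- No `a` has a value in `[]`, so unfolding the fixed point there supplies `b`; unfolding again at
  -- the extended list shows that it meets `T`.
  compatible-value : ∀ a → ∃ₚ λ b → (a , b) ∷ [] ∈ T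
  compatible-value a =
    Irrelevant.map
      (λ (b , ab∈Ap) → b , singleton-∈ (proj₁ (Ap-postfixed T ab∈Ap)) (here refl))
      (proj₂ (Ap-postfixed T approx) a λ b∈[] → irrelevant⇒¬¬ b∈[] λ { (_ , ()) })

  maximal⇒total : ∀ {f} → f ∈ Max-dpf ⟨ T ⟩ → ∀ a → a ∈ dom f
  maximal⇒total {f} (f∈⟨T⟩ , f-max) a fa≡nothing =
    irrelevant⇒¬¬ (compatible-value a) λ (b , ab∈T) →
      f-max (extend _≟_ f a b) (extend-≺ _≟_ f a b fa≡nothing)
        (singletons⇒∈⟨T⟩ prime []∈T λ (x , y) eq →
          case-graph ab∈T (graph-extend _≟_ f a b x y eq))
    where
    case-graph : ∀ {b p} → (a , b) ∷ [] ∈ T →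
                 p ≡ (a , b) ⊎ p ∈ graph⊥ f → p ∷ [] ∈ T
    case-graph ab∈T (inj₁ refl) = ab∈T
    case-graph ab∈T (inj₂ p∈f)  = singleton-∈ f∈⟨T⟩ p∈f

theorem38 : ∀ {ℓ} {A B : Set ℓ} → DecidableEquality A →
    (T : Pred (List (A × B)) ℓ) → DownwardPrime T →
    ∃MPCF T → GDC T
theorem38 _≟_ T prime mpcf approx =
  -- Approximability unfolded at `[]` puts the empty predicate in `⟨ T ⟩`.
  Irrelevant.map choice (mpcf [ ⟨ [] ⟩ˡ , proj₁ (Ap-postfixed T approx) ])
  where
  choice : (∃ λ f → f ∈ Max-dpf ⟨ T ⟩) →
           ∃ λ (h : _ → _) → ∀ u → u ⊂ˡ graph T h → u ∈ T
  choice (f , f-max@(f∈⟨T⟩ , _)) =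
    -- The graph of the resulting function is contained in `graph⊥ f`, so `f∈⟨T⟩` covers its finite
    -- sublists.
    proj₁ ∘ value , λ u u⊂h → f∈⟨T⟩ u λ (a , b) ab∈u →
      trans (proj₂ (value a)) (cong just (u⊂h (a , b) ab∈u))
    where
    value : ∀ a → ∃ λ b → f a ≡ just b
    value a = ≢nothing⇒just (f a) (maximal⇒total _≟_ prime approx f-max a)
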